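{- Consider a PEPA system comprising $n$ types of component $C_1, C_2, \ldots, C_n$, with $M_i$ copies of the component of type $C_i$ in the system, where $C_i$ has $d_i$ distinct local derivatives, for $i=1,2,\ldots,n$. Then the size of the state space of the system (the number of states in numerical vector form) is at most $$\prod_{i=1}^n \binom{M_i+d_i-1}{d_i-1},$$ and moreover $$\prod_{i=1}^n \binom{M_i+d_i-1}{d_i-1}\le \prod_{i=1}^n (M_i+d_i-1)^{d_i-1}.$$
   Context: PEPA is a stochastic process algebra. A PEPA model is a parallel composition (with cooperation over sets of action types) of finitely many sequential components. Each sequential component belongs to one of finitely many component types $C_1,\dots,C_n$. A local derivative of type $C_i$ is a local state of a single sequential component of that type; type $C_i$ has $d_i\geq 1$ distinct local derivatives $C_{i_1},\dots,C_{i_{d_i}}$. At any time each sequential component is in one and only one local derivative of its type, and the number $M_i$ of sequential components of type $C_i$ does not change as the system evolves. Numerical vector form: a state of the model is represented by the vector $\mathbf{m}$ with $d=\sum_{i=1}^n d_i$ entries, whose entry $\mathbf{m}[C_{i_j}]$ is the number of instances of the $j$th local derivative of component type $C_i$ exhibited in the current state. Thus $\mathbf{m}[C_{i_j}]$ is a nonnegative integer and $\sum_{j=1}^{d_i}\mathbf{m}[C_{i_j}]=M_i$ for each $i$. The state space of the system is the set of numerical vectors $\mathbf{m}$ representing the states reachable from the initial state; its size is the number of such vectors. -}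

module Defs where

open import Data.Fin using (Fin)
open import Data.Fin.Properties using (toℕ<n) renaming (_≟_ to _≟ᶠ_)
open import Data.List using (List; []; _∷_; _++_; map; filter; length; product; tabulate)
open import Data.List.Membership.Propositional using (_∈_; _∉_)
open import Data.Nat using (ℕ; _≤_; z≤n; s≤s)
open import Data.Nat.Properties using (≤-trans)
open import Data.Product using (Σ; ∃; ∃-syntax; _×_; _,_; proj₁; proj₂)
open import Data.Product.Properties using (≡-dec)
open import Function using (_∘_)
open import Function.Definitions using (Injective)
open import Relation.Binary.Bundles using (Setoid)
open import Relation.Binary.Construct.Closure.ReflexiveTransitive using (Star; ε)
import Relation.Binary.Construct.On as On
open import Relation.Binary.Definitions using (DecidableEquality)
open import Relation.Binary.PropositionalEquality using (_≡_; _≗_; _→-setoid_)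
open import Relation.Unary using (Pred; Decidable)

∏ : ∀ {n} → (Fin n → ℕ) → ℕ
∏ f = product (tabulate f)

count : ∀ {A : Set} {P : A → Set} → Decidable P → List A → ℕ
count P? xs = length (filter P? xs)

-- Action types: `τ` is the hidden type, which cannot occur in a cooperation
-- set or a hiding set.
data ActionType (Act : Set) : Set where
  act : Act → ActionType Act
  τ   : ActionType Act

data Sequential (Act Rate Const : Set) : Set where
  ⟨_,_⟩∙_ : ActionType Act → Rate → Sequential Act Rate Const → Sequential Act Rate Const
  _⊕_     : (S T : Sequential Act Rate Const) → Sequential Act Rate Const
  con     : Const → Sequential Act Rate Const

record Definitions : Set₁ where
  field
    Act Rate Const : Set
    body           : Const → Sequential Act Rate Const

-- Transitions are labelled by action types only.  In PEPA every rate is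
-- positive or passive, so rates never decide whether a transition exists, and
-- hence have no influence on which states are reachable.
module SequentialSemantics (𝓓 : Definitions) where
  open Definitions 𝓓

  Seq : Set
  Seq = Sequential Act Rate Const

  data _-[_]→ˢ_ : Seq → ActionType Act → Seq → Set where
    prefix   : ∀ {α r S} → (⟨ α , r ⟩∙ S) -[ α ]→ˢ S
    choiceˡ  : ∀ {α S S′ T} → S -[ α ]→ˢ S′ → (S ⊕ T) -[ α ]→ˢ S′
    choiceʳ  : ∀ {α S T T′} → T -[ α ]→ˢ T′ → (S ⊕ T) -[ α ]→ˢ T′
    constant : ∀ {α A S} → body A -[ α ]→ˢ S → con A -[ α ]→ˢ S

  _IsDerivativeOf_ : Seq → Seq → Set
  S′ IsDerivativeOf S = Star (λ T T′ → ∃[ α ] T -[ α ]→ˢ T′) S S′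

open SequentialSemantics using (Seq; _IsDerivativeOf_)

-- Component types C₁, …, Cₙ, where Cᵢ has exactly d i distinct local
-- derivatives; derivatives are distinguished syntactically.
record ComponentTypes (𝓓 : Definitions) {n : ℕ} (d : Fin n → ℕ) : Set where
  field
    C          : Fin n → Definitions.Const 𝓓
    derivative : (i : Fin n) → Fin (d i) → Seq 𝓓
    distinct   : ∀ i → Injective _≡_ _≡_ (derivative i)
    sound      : ∀ i j → _IsDerivativeOf_ 𝓓 (derivative i j) (con (C i))
    complete   : ∀ i {S} → _IsDerivativeOf_ 𝓓 S (con (C i)) → ∃[ j ] derivative i j ≡ S

-- d i ≥ 1 need not be assumed: Cᵢ is one of its own derivatives.
1≤d : ∀ {𝓓 n} {d : Fin n → ℕ} → ComponentTypes 𝓓 d → ∀ i → 1 ≤ d i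
1≤d T i = ≤-trans (s≤s z≤n) (toℕ<n (proj₁ (ComponentTypes.complete T i ε)))

-- (i , j) stands for the j-th local derivative of type Cᵢ.
LocalDerivative : ∀ {n} → (Fin n → ℕ) → Set
LocalDerivative {n} d = Σ (Fin n) (Fin ∘ d)

_≟_ : ∀ {n} {d : Fin n → ℕ} → DecidableEquality (LocalDerivative d)
_≟_ = ≡-dec _≟ᶠ_ _≟ᶠ_

NumericalVector : ∀ {n} → (Fin n → ℕ) → Set
NumericalVector d = LocalDerivative d → ℕ

module System {𝓓 : Definitions} {n : ℕ} {d : Fin n → ℕ} (T : ComponentTypes 𝓓 d) where
  open Definitions 𝓓
  open SequentialSemantics 𝓓 hiding (Seq; _IsDerivativeOf_)
  open ComponentTypes T

  data Model : Set where
    component : (i : Fin n) → Fin (d i) → Model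
    _⋈[_]_    : Model → List Act → Model → Model
    _/_       : Model → List Act → Model

  data _-[_]→_ : Model → ActionType Act → Model → Set where
    -- By `complete`, every transition of a local derivative of Cᵢ leads to
    -- some `derivative i j′`, so no transition is lost here.
    local   : ∀ {α i j j′} → derivative i j -[ α ]→ˢ derivative i j′ →
              component i j -[ α ]→ component i j′
    aloneˡ  : ∀ {α L P P′ Q} → α ∉ map act L → P -[ α ]→ P′ →
              (P ⋈[ L ] Q) -[ α ]→ (P′ ⋈[ L ] Q)
    aloneʳ  : ∀ {α L P Q Q′} → α ∉ map act L → Q -[ α ]→ Q′ →
              (P ⋈[ L ] Q) -[ α ]→ (P ⋈[ L ] Q′)
    shared  : ∀ {a L P P′ Q Q′} → a ∈ L → P -[ act a ]→ P′ → Q -[ act a ]→ Q′ →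
              (P ⋈[ L ] Q) -[ act a ]→ (P′ ⋈[ L ] Q′)
    visible : ∀ {α L P P′} → α ∉ map act L → P -[ α ]→ P′ →
              (P / L) -[ α ]→ (P′ / L)
    hidden  : ∀ {a L P P′} → a ∈ L → P -[ act a ]→ P′ →
              (P / L) -[ τ ]→ (P′ / L)

  Reachable : Model → Model → Set
  Reachable = Star (λ P P′ → ∃[ α ] P -[ α ]→ P′)

  components : Model → List (LocalDerivative d)
  components (component i j) = (i , j) ∷ []
  components (P ⋈[ L ] Q)    = components P ++ components Q
  components (P / L)         = components P

  copies : Model → Fin n → ℕ
  copies P i = count (λ c → proj₁ c ≟ᶠ i) (components P)

  numericalVector : Model → NumericalVector d
  numericalVector P c = count (_≟ c) (components P)

  StateSpace : Model → Pred (NumericalVector d) _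
  StateSpace P₀ m = ∃[ P ] Reachable P₀ P × numericalVector P ≗ m

  -- Vectors are compared entrywise; the reachability witness is irrelevant.
  stateSpace : Model → Setoid _ _
  stateSpace P₀ = On.setoid {B = ∃ (StateSpace P₀)} (LocalDerivative d →-setoid ℕ) proj₁

open System public using (Model; copies; stateSpace)

{-# OPTIONS --safe #-}

-- Stars and bars is realised by an explicit ranking.  The vectors of length
-- k + 1 with sum M are ordered by their head: those with head 0 come first and
-- fill the first (M + k - 1) C (k - 1) ranks, and those with positive head
-- follow in the order of the vectors with head one smaller.  Pascal's rule
-- bounds the ranks by (M + k) C k.  Transitions preserve the number of
-- components of each type, so the block of type Cᵢ of a reachable numerical
-- vector has sum Mᵢ; its ranks, for all i, are the digits of a mixed radix code.
module Submission where

open import Defs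
open import Data.Fin using (Fin; zero; suc; combine; fromℕ<)
open import Data.Fin.Properties using
  (≡-setoid; combine-injectiveˡ; combine-injectiveʳ; fromℕ<-cong; fromℕ<-injective; suc-injective) renaming (_≟_ to _≟ᶠ_)
open import Data.List using (List; []; _∷_; _++_; filter; length)
open import Data.List.Properties using (length-++; filter-++; filter-accept; filter-reject)
open import Data.Nat using (ℕ; zero; suc; _+_; _*_; _∸_; _^_; _≤_; _<_; z≤n; s≤s)
open import Data.Nat.Combinatorics using (_C_; nCk+nC[k+1]≡[n+1]C[k+1])
open import Data.Nat.Properties hiding (_≟_; suc-injective)
open import Data.Product using (∃; _×_; _,_; proj₁)
open import Data.Vec using (Vec; []; _∷_; sum; tabulate; lookup)
open import Data.Vec.Properties using (tabulate-cong; lookup∘tabulate)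
open import Function using (_∘_; case_of_)
open import Function.Bundles using (Injection)
open import Relation.Binary.Construct.Closure.ReflexiveTransitive using (ε; _◅_)
open import Relation.Binary.PropositionalEquality using
  (_≡_; _≢_; _≗_; refl; sym; trans; cong; cong₂; subst; module ≡-Reasoning)
open import Relation.Nullary using (¬_; yes; no; contradiction)
open import Relation.Unary using (Decidable)

-- Induction along Pascal's rule: the two summands are at most `n ^ k` and `n ^ suc k`, which add up
-- to `suc n * n ^ k`.
nCk≤n^k : ∀ n k → n C k ≤ n ^ k
nCk≤n^k n       zero    = ≤-refl
nCk≤n^k zero    (suc k) = ≤-refl
nCk≤n^k (suc n) (suc k) = begin
  suc n C suc k       ≡⟨ nCk+nC[k+1]≡[n+1]C[k+1] n k ⟨
  n C k + n C suc k   ≤⟨ +-mono-≤ (nCk≤n^k n k) (nCk≤n^k n (suc k)) ⟩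
  suc n * n ^ k       ≤⟨ *-monoʳ-≤ (suc n) (^-monoˡ-≤ k (n≤1+n n)) ⟩
  suc n * suc n ^ k   ∎
  where open ≤-Reasoning

∏-mono-≤ : ∀ {n} {f g : Fin n → ℕ} → (∀ i → f i ≤ g i) → ∏ f ≤ ∏ g
∏-mono-≤ {zero}  f≤g = ≤-refl
∏-mono-≤ {suc n} f≤g = *-mono-≤ (f≤g zero) (∏-mono-≤ (f≤g ∘ suc))

mixedRadix : ∀ {n} {m : Fin n → ℕ} → (∀ i → Fin (m i)) → Fin (∏ m)
mixedRadix {zero}  f = zero
mixedRadix {suc n} f = combine (f zero) (mixedRadix (f ∘ suc))

mixedRadix-cong : ∀ {n} {m : Fin n → ℕ} {f g : ∀ i → Fin (m i)} →
                  (∀ i → f i ≡ g i) → mixedRadix f ≡ mixedRadix g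
mixedRadix-cong {zero}  f≗g = refl
mixedRadix-cong {suc n} f≗g = cong₂ combine (f≗g zero) (mixedRadix-cong (f≗g ∘ suc))

-- Both arguments of `combine` can be recovered from its value, so the digits split off one at a
-- time.
mixedRadix-injective : ∀ {n} {m : Fin n → ℕ} (f g : ∀ i → Fin (m i)) →
                       mixedRadix f ≡ mixedRadix g → ∀ i → f i ≡ g i
mixedRadix-injective f g eq zero    = combine-injectiveˡ (f zero) _ (g zero) _ eq
mixedRadix-injective f g eq (suc i) =
  mixedRadix-injective (f ∘ suc) (g ∘ suc) (combine-injectiveʳ (f zero) _ (g zero) _ eq) i

rank : ∀ {k} → Vec ℕ k → ℕ
rank []                 = 0
rank (x ∷ [])           = 0
rank (zero ∷ v@(_ ∷ _)) = rank v
-- The binomial counts the vectors with head 0 and the same sum: their tails have `suc k` entries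
-- with sum `suc x + sum v`.
rank {suc (suc k)} (suc x ∷ v@(_ ∷ _)) = (suc x + sum v + k) C k + rank (x ∷ v)

-- Of the two summands in Pascal's rule, the first bounds the ranks with head 0 and is the offset
-- for a positive head; the second bounds the rank left after lowering that head by one.
rank-< : ∀ {k} (v : Vec ℕ (suc k)) → rank v < (sum v + k) C k
rank-< (x ∷ [])             = s≤s z≤n
rank-< {suc k} (zero ∷ v@(_ ∷ _)) = begin-strict
  rank v                                <⟨ rank-< v ⟩
  (sum v + k) C k                       ≤⟨ m≤m+n _ _ ⟩
  (sum v + k) C k + (sum v + k) C suc k ≡⟨ nCk+nC[k+1]≡[n+1]C[k+1] (sum v + k) k ⟩
  suc (sum v + k) C suc k               ≡⟨ cong (_C suc k) (+-suc (sum v) k) ⟨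
  (sum v + suc k) C suc k               ∎
  where open ≤-Reasoning
rank-< {suc k} (suc x ∷ v@(_ ∷ _)) = begin-strict
  (suc s + k) C k + rank (x ∷ v)           <⟨ +-monoʳ-< _ (rank-< (x ∷ v)) ⟩
  (suc s + k) C k + (s + suc k) C suc k    ≡⟨ cong (λ z → z C k + (s + suc k) C suc k) (+-suc s k) ⟨
  (s + suc k) C k + (s + suc k) C suc k    ≡⟨ nCk+nC[k+1]≡[n+1]C[k+1] (s + suc k) k ⟩
  (suc s + suc k) C suc k                  ∎
  where
  open ≤-Reasoning
  s = x + sum v

-- The offset in `rank (suc y ∷ w)` is exactly the bound of `rank-<` for `v`, so the two ranges of
-- ranks are disjoint.
rank[0∷v]≢rank[1+y∷w] : ∀ {k} y (v w : Vec ℕ (suc k)) → sum v ≡ suc y + sum w →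
                        rank (zero ∷ v) ≢ rank (suc y ∷ w)
rank[0∷v]≢rank[1+y∷w] {k} y v@(_ ∷ _) w@(_ ∷ _) s≡ r≡ = <-irrefl r≡ (begin-strict
  rank v                              <⟨ rank-< v ⟩
  (sum v + k) C k                     ≡⟨ cong (λ s → (s + k) C k) s≡ ⟩
  (suc y + sum w + k) C k             ≤⟨ m≤m+n _ _ ⟩
  rank (suc y ∷ w)                    ∎)
  where open ≤-Reasoning

-- Ranks separate only vectors of equal sum: for instance, all one-entry vectors have rank 0.
rank-injective : ∀ {k} (v w : Vec ℕ k) → sum v ≡ sum w → rank v ≡ rank w → v ≡ w
rank-injective []       []       _  _ = refl
rank-injective (x ∷ []) (y ∷ []) s≡ _ = cong (_∷ []) (+-cancelʳ-≡ 0 x y s≡)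
rank-injective (zero ∷ v@(_ ∷ _)) (zero ∷ w@(_ ∷ _)) s≡ r≡ =
  cong (0 ∷_) (rank-injective v w s≡ r≡)
rank-injective (zero ∷ v@(_ ∷ _)) (suc y ∷ w@(_ ∷ _)) s≡ r≡ =
  contradiction r≡ (rank[0∷v]≢rank[1+y∷w] y v w s≡)
rank-injective (suc x ∷ v@(_ ∷ _)) (zero ∷ w@(_ ∷ _)) s≡ r≡ =
  contradiction (sym r≡) (rank[0∷v]≢rank[1+y∷w] x w v (sym s≡))
rank-injective {suc (suc k)} (suc x ∷ v@(_ ∷ _)) (suc y ∷ w@(_ ∷ _)) s≡ r≡
  -- The offsets depend only on the common sum, so they cancel and leave the ranks of the vectors
  -- with heads lowered by one.
  with rank-injective (x ∷ v) (y ∷ w) (cong (_∸ 1) s≡)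
         (+-cancelˡ-≡ ((suc x + sum v + k) C k) _ _
           (trans r≡ (cong (λ s → (s + k) C k + rank (y ∷ w)) (sym s≡))))
... | refl = refl

-- For k = 0 the truncated subtractions leave 0 C 0 = 1, which is the right count.
rank-<-∸ : ∀ {k} (v : Vec ℕ k) → rank v < (sum v + k ∸ 1) C (k ∸ 1)
rank-<-∸ []              = s≤s z≤n
rank-<-∸ {suc k} v@(_ ∷ _) =
  subst (λ s → rank v < (s ∸ 1) C k) (sym (+-suc (sum v) k)) (rank-< v)

-- Serves to add one component to a list: a single entry of its block grows by one, and hence so
-- does the sum.
sum-tabulate-suc : ∀ {k} {f g : Fin k → ℕ} (j : Fin k) → f j ≡ suc (g j) →
                   (∀ l → j ≢ l → f l ≡ g l) → sum (tabulate f) ≡ suc (sum (tabulate g))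
sum-tabulate-suc zero fj≡ f≡g =
  cong₂ _+_ fj≡ (cong sum (tabulate-cong (λ l → f≡g (suc l) (λ ()))))
sum-tabulate-suc {g = g} (suc j) fj≡ f≡g = trans
  (cong₂ _+_ (f≡g zero (λ ()))
             (sum-tabulate-suc j fj≡ (λ l j≢l → f≡g (suc l) (j≢l ∘ suc-injective))))
  (+-suc (g zero) _)

sum-tabulate-0 : ∀ k → sum (tabulate {n = k} (λ _ → 0)) ≡ 0
sum-tabulate-0 zero    = refl
sum-tabulate-0 (suc k) = sum-tabulate-0 k

module _ {A : Set} {P : A → Set} (P? : Decidable P) where

  count-accept : ∀ x xs → P x → count P? (x ∷ xs) ≡ suc (count P? xs)
  count-accept _ _ Px = cong length (filter-accept P? Px)

  count-reject : ∀ x xs → ¬ P x → count P? (x ∷ xs) ≡ count P? xs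
  count-reject _ _ ¬Px = cong length (filter-reject P? ¬Px)

  count-++ : ∀ xs ys → count P? (xs ++ ys) ≡ count P? xs + count P? ys
  count-++ xs ys = trans
    (cong length (filter-++ P? xs ys))
    (length-++ (filter P? xs))

-- Each component of type `i` is counted in exactly one entry of the block, a component of another
-- type in none.
sum-count : ∀ {n} {d : Fin n → ℕ} (i : Fin n) (cs : List (LocalDerivative d)) →
            sum (tabulate (λ j → count (_≟ (i , j)) cs)) ≡ count (λ c → proj₁ c ≟ᶠ i) cs
sum-count {d = d} i [] = sum-tabulate-0 (d i)
sum-count {d = d} i (c@(i′ , j′) ∷ cs) = case i′ ≟ᶠ i of λ
  { (yes refl) → begin
      sum (tabulate (λ j → count (_≟ (i , j)) (c ∷ cs)))
        ≡⟨ sum-tabulate-suc j′ (count-accept (_≟ (i , j′)) c cs refl)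
             (λ j j′≢j → count-reject (_≟ (i , j)) c cs (λ { refl → j′≢j refl })) ⟩
      suc (sum (tabulate (λ j → count (_≟ (i , j)) cs)))
        ≡⟨ cong suc (sum-count i cs) ⟩
      suc (count hasType? cs)
        ≡⟨ count-accept hasType? c cs refl ⟨
      count hasType? (c ∷ cs) ∎
  ; (no i′≢i) → begin
      sum (tabulate (λ j → count (_≟ (i , j)) (c ∷ cs)))
        ≡⟨ cong sum (tabulate-cong (λ j → count-reject (_≟ (i , j)) c cs (i′≢i ∘ cong proj₁))) ⟩
      sum (tabulate (λ j → count (_≟ (i , j)) cs))
        ≡⟨ sum-count i cs ⟩
      count hasType? cs
        ≡⟨ count-reject hasType? c cs i′≢i ⟨
      count hasType? (c ∷ cs) ∎
  }
  where
  open ≡-Reasoning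
  hasType? : Decidable (λ (c : LocalDerivative d) → proj₁ c ≡ i)
  hasType? c = proj₁ c ≟ᶠ i

module _ {𝓓 : Definitions} {n : ℕ} {d : Fin n → ℕ} (T : ComponentTypes 𝓓 d) where
  open System T hiding (Model; copies; stateSpace)

  copies-⋈ : ∀ P L Q i → copies T (P ⋈[ L ] Q) i ≡ copies T P i + copies T Q i
  copies-⋈ P L Q i = count-++ (λ c → proj₁ c ≟ᶠ i) (components P) (components Q)

  copies-⋈-cong : ∀ {P P′ Q Q′} L → copies T P ≗ copies T P′ → copies T Q ≗ copies T Q′ →
                  copies T (P ⋈[ L ] Q) ≗ copies T (P′ ⋈[ L ] Q′)
  copies-⋈-cong {P} {P′} {Q} {Q′} L p q i = begin
    copies T (P ⋈[ L ] Q) i       ≡⟨ copies-⋈ P L Q i ⟩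
    copies T P i + copies T Q i   ≡⟨ cong₂ _+_ (p i) (q i) ⟩
    copies T P′ i + copies T Q′ i ≡⟨ copies-⋈ P′ L Q′ i ⟨
    copies T (P′ ⋈[ L ] Q′) i     ∎
    where open ≡-Reasoning

  -- A `local` step changes the derivative of a component but keeps its type `i`; the other rules
  -- only pass to subterms.
  copies-step : ∀ {α P P′} → P -[ α ]→ P′ → copies T P ≗ copies T P′
  copies-step (local {i = i} _) i′ with i ≟ᶠ i′
  ... | yes _ = refl
  ... | no  _ = refl
  copies-step (aloneˡ {L = L} {P} {P′} {Q} _ s) =
    copies-⋈-cong {P} {P′} {Q} {Q} L (copies-step s) (λ _ → refl)
  copies-step (aloneʳ {L = L} {P} {Q} {Q′} _ s) =
    copies-⋈-cong {P} {P} {Q} {Q′} L (λ _ → refl) (copies-step s)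
  copies-step (shared {L = L} {P} {P′} {Q} {Q′} _ s t) =
    copies-⋈-cong {P} {P′} {Q} {Q′} L (copies-step s) (copies-step t)
  copies-step (visible _ s) = copies-step s
  copies-step (hidden _ s)  = copies-step s

  copies-reachable : ∀ {P P′} → Reachable P P′ → copies T P ≗ copies T P′
  copies-reachable ε              i = refl
  copies-reachable ((_ , s) ◅ ss) i = trans (copies-step s i) (copies-reachable ss i)

  -- Tabulation turns entrywise equality of numerical vectors into propositional equality, which
  -- `rank` respects.
  block : NumericalVector d → (i : Fin n) → Vec ℕ (d i)
  block m i = tabulate (λ j → m (i , j))

  block-cong : ∀ {m m′} → m ≗ m′ → ∀ i → block m i ≡ block m′ i
  block-cong m≗m′ i = tabulate-cong (λ j → m≗m′ (i , j))

  block-injective : ∀ {m m′} → (∀ i → block m i ≡ block m′ i) → m ≗ m′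
  block-injective {m} {m′} eq (i , j) = begin
    m (i , j)             ≡⟨ lookup∘tabulate _ j ⟨
    lookup (block m i) j  ≡⟨ cong (λ v → lookup v j) (eq i) ⟩
    lookup (block m′ i) j ≡⟨ lookup∘tabulate _ j ⟩
    m′ (i , j)            ∎
    where open ≡-Reasoning

  sum-block : ∀ {P₀ m} → StateSpace P₀ m → ∀ i → sum (block m i) ≡ copies T P₀ i
  sum-block {P₀} {m} (P , reach , nv≗m) i = begin
    sum (block m i)                   ≡⟨ cong sum (block-cong nv≗m i) ⟨
    sum (block (numericalVector P) i) ≡⟨ sum-count i (components P) ⟩
    copies T P i                      ≡⟨ copies-reachable reach i ⟨
    copies T P₀ i                     ∎
    where open ≡-Reasoning

proposition1 : (𝓓 : Definitions) (n : ℕ) (d M : Fin n → ℕ) (T : ComponentTypes 𝓓 d)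
    (P₀ : Model T) → (∀ i → copies T P₀ i ≡ M i) →
    Injection (stateSpace T P₀) (≡-setoid (∏ (λ i → (M i + d i ∸ 1) C (d i ∸ 1))))
    × ∏ (λ i → (M i + d i ∸ 1) C (d i ∸ 1)) ≤ ∏ (λ i → (M i + d i ∸ 1) ^ (d i ∸ 1))
proposition1 𝓓 n d M T P₀ copies≡M =
  record
    { to        = λ s → mixedRadix (λ i → fromℕ< (bound s i))
    -- The digits depend on the ranks alone, not on the reachability witnesses that enter `bound`.
    ; cong      = λ {s} {t} m≗m′ → mixedRadix-cong (λ i →
        fromℕ<-cong _ _ (cong rank (block-cong T m≗m′ i)) (bound s i) (bound t i))
    ; injective = λ {s} {t} eq → block-injective T (λ i →
        -- Both blocks have sum `M i`, as injectivity of `rank` requires.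
        rank-injective _ _ (trans (sum≡M s i) (sym (sum≡M t i)))
          (fromℕ<-injective _ _ (bound s i) (bound t i) (mixedRadix-injective _ _ eq i)))
    }
  , ∏-mono-≤ (λ i → nCk≤n^k (M i + d i ∸ 1) (d i ∸ 1))
  where
  open System T using (StateSpace)

  sum≡M : (s : ∃ (StateSpace P₀)) → ∀ i → sum (block T (proj₁ s) i) ≡ M i
  sum≡M (_ , reachable) i = trans (sum-block T reachable i) (copies≡M i)

  bound : (s : ∃ (StateSpace P₀)) → ∀ i →
          rank (block T (proj₁ s) i) < (M i + d i ∸ 1) C (d i ∸ 1)
  bound s i = subst (λ x → rank (block T (proj₁ s) i) < (x + d i ∸ 1) C (d i ∸ 1))
                (sum≡M s i) (rank-<-∸ (block T (proj₁ s) i))
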